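{- In base $B=3$, for every integer $\eta>2$, $$\gamma_3(\eta)=4\left(\frac{3^{ -1/2}}{2}\,3\uparrow\uparrow(\eta-2)\right)^{7/2}-1,$$ i.e. with $E_1=\frac{3^{ -1/2}}{2}\,3^{7/2}$ and $E_{m+1}=\frac{3^{ -1/2}}{2}\,3^{E_m}$ for $m\ge1$, one has $\gamma_3(\eta)=4E_{\eta-2}-1$.
   Context: Every integer $x>0$ is written uniquely in base $3$ as $x=\sum_{i} x_i 3^i$ with digits $x_i\in\{0,1,2\}$. Define $\mathcal{H}_3(x)=\sum_{i} x_i^2$, $\mathcal{H}_3^0(x)=x$, $\mathcal{H}_3^n=\mathcal{H}_3\circ\mathcal{H}_3^{n-1}$. A positive integer $x$ is happy if $\mathcal{H}_3^n(x)=1$ for some $n\in\mathbb{N}$; its height is $\eta_3(x)=\min\{\alpha\in\mathbb{N}:\mathcal{H}_3^\alpha(x)=1\}$. For $n\in\mathbb{N}$, $\gamma_3(n)$ denotes the smallest happy number $x\ge1$ with $\eta_3(x)=n$. Adapted up-arrow notation: for reals $k,x,y,z$ and integer $n\ge1$, $k(xy\uparrow\uparrow n)^z=k\,E_n$ where $E_1=x\,y^{z}$ and $E_{m+1}=x\,y^{E_m}$ (the factor "$xy$" is repeated $n$ times in the tower $k\,x y^{x y^{\cdot^{\cdot^{x y^{z}}}}}$); here $k=4$, $x=\frac{3^{ -1/2}}{2}$, $y=3$, $z=\frac72$. -}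

module Defs where

open import Data.Digit using (toDigits)
open import Data.Fin.Base using (toℕ)
open import Data.Integer.Base as ℤ using (ℤ; +_; -[1+_])
import Data.Integer.Properties as ℤₚ
open import Data.List.Base using (map)
open import Data.Nat.Base as ℕ using (ℕ; zero; suc)
open import Data.Nat.ListAction using (sum)
import Data.Nat.Properties as ℕₚ
open import Data.Product.Base using (∃; ∃-syntax; _×_; _,_; proj₁)
open import Data.Rational.Base using (ℚ; 0ℚ; 1ℚ; _<_; _≤_; _+_; _*_; -_; 1/_; _⊓_; *<*; ↥_; ↧_; ↧ₙ_; Positive; NonZero; positive; nonNegative; >-nonZero; _/_)
open import Data.Rational.Properties
open import Data.Sum.Base using (_⊎_; inj₁; inj₂)
open import Function.Bundles using (_⇔_)
open import Relation.Binary.Definitions using (tri<; tri≈; tri>)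
open import Relation.Binary.PropositionalEquality using (_≡_; refl; sym; trans; cong; subst; subst₂)
open import Relation.Nullary using (¬_; yes; no; contradiction)
open import Algebra.Bundles using (CommutativeRing)
open import Algebra.Properties.Semiring.Exp (CommutativeRing.semiring +-*-commutativeRing) using (_^_; ^-assocʳ)

------------------------------------------------------------------------
-- Happy numbers in base 3

H₃ : ℕ → ℕ
H₃ x = sum (map (λ d → toℕ d ℕ.^ 2) (proj₁ (toDigits 3 x)))

H₃^ : ℕ → ℕ → ℕ
H₃^ zero    x = x
H₃^ (suc n) x = H₃ (H₃^ n x)

Happy : ℕ → Set
Happy x = 1 ℕ.≤ x × ∃[ n ] H₃^ n x ≡ 1

IsLeast : (ℕ → Set) → ℕ → Set
IsLeast P m = P m × (∀ k → P k → m ℕ.≤ k)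

-- IsHeight x α is "η₃(x) = α", and Isγ₃ n g is "γ₃(n) = g".

IsHeight : ℕ → ℕ → Set
IsHeight x = IsLeast (λ α → H₃^ α x ≡ 1)

Isγ₃ : ℕ → ℕ → Set
Isγ₃ n = IsLeast (λ x → Happy x × IsHeight x n)

γ₃-unique : ∀ {n g h} → Isγ₃ n g → Isγ₃ n h → g ≡ h
γ₃-unique (p , p-least) (q , q-least) = ℕₚ.≤-antisym (p-least _ q) (q-least _ p)

------------------------------------------------------------------------
-- Real numbers as Dedekind cuts: a real is identified with the set of
-- rationals strictly below it.

record ℝ : Set₁ where
  field
    below     : ℚ → Set
    inhabited : ∃ below
    bounded   : ∃[ q ] ¬ below q
    down      : ∀ {p q} → p < q → below q → below p
    open-up   : ∀ {p} → below p → ∃[ q ] (p < q × below q)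

open ℝ

infix 4 _≃_
_≃_ : ℝ → ℝ → Set
x ≃ y = ∀ q → below x q ⇔ below y q

record ℝ⁺ : Set₁ where
  field
    real : ℝ
    pos  : below real 0ℚ

open ℝ⁺ public using (real)
open ℝ⁺ using (pos)

module CutLemmas where
  <⇒≱ : ∀ {p q} → p < q → ¬ (q ≤ p)
  <⇒≱ p<q q≤p = <-irrefl refl (<-≤-trans p<q q≤p)

  0<1 : 0ℚ < 1ℚ
  0<1 = *<* (ℤ.+<+ (ℕ.s≤s ℕ.z≤n))

  p<p+1 : ∀ p → p < p + 1ℚ
  p<p+1 p = subst (_< p + 1ℚ) (+-identityʳ p) (+-monoʳ-< p 0<1)

  p-1<p : ∀ p → p + - 1ℚ < p
  p-1<p p = subst (p + - 1ℚ <_) (+-identityʳ p) (+-monoʳ-< p (*<* ℤ.-<+))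

  below⇒< : ∀ x {p u} → ¬ below x u → below x p → p < u
  below⇒< x {p} {u} u∉ p∈ with <-cmp p u
  ... | tri< p<u _ _    = p<u
  ... | tri≈ _ refl _   = contradiction p∈ u∉
  ... | tri> _ _ u<p    = contradiction (down x u<p p∈) u∉

  *-mono-<-≤⁺ : ∀ {a b c d} → 0ℚ ≤ a → 0ℚ < d → a < b → c ≤ d → a * c < b * d
  *-mono-<-≤⁺ {a} {b} {c} {d} 0≤a 0<d a<b c≤d =
    ≤-<-trans (*-monoˡ-≤-nonNeg a {{nonNegative 0≤a}} c≤d)
              (*-monoˡ-<-pos d {{positive 0<d}} a<b)

  *-mono-≤⁺ : ∀ {a b c d} → 0ℚ ≤ a → 0ℚ ≤ d → a ≤ b → c ≤ d → a * c ≤ b * d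
  *-mono-≤⁺ {a} {b} {c} {d} 0≤a 0≤d a≤b c≤d =
    ≤-trans (*-monoˡ-≤-nonNeg a {{nonNegative 0≤a}} c≤d)
            (*-monoʳ-≤-nonNeg d {{nonNegative 0≤d}} a≤b)

  0<* : ∀ {a b} → 0ℚ < a → 0ℚ < b → 0ℚ < a * b
  0<* {a} {b} 0<a 0<b =
    subst (_< a * b) (*-zeroˡ b) (*-monoˡ-<-pos b {{positive 0<b}} 0<a)

  0≤^ : ∀ {a} n → 0ℚ ≤ a → 0ℚ ≤ a ^ n
  0≤^ zero    0≤a = <⇒≤ 0<1
  0≤^ {a} (suc n) 0≤a =
    subst (_≤ a * a ^ n) (*-zeroʳ a) (*-monoˡ-≤-nonNeg a {{nonNegative 0≤a}} (0≤^ n 0≤a))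

  0<^ : ∀ {a} n → 0ℚ < a → 0ℚ < a ^ n
  0<^ zero    0<a = 0<1
  0<^ (suc n) 0<a = 0<* 0<a (0<^ n 0<a)

  ^-mono : ∀ {a b} n → 0ℚ ≤ a → a ≤ b → a ^ n ≤ b ^ n
  ^-mono zero    0≤a a≤b = ≤-refl
  ^-mono (suc n) 0≤a a≤b =
    *-mono-≤⁺ 0≤a (0≤^ n (≤-trans 0≤a a≤b)) a≤b (^-mono n 0≤a a≤b)

  1^ : ∀ n → 1ℚ ^ n ≡ 1ℚ
  1^ zero    = refl
  1^ (suc n) = trans (*-identityˡ (1ℚ ^ n)) (1^ n)

  1≤^ : ∀ {b} n → 1ℚ ≤ b → 1ℚ ≤ b ^ n
  1≤^ {b} n 1≤b = subst (_≤ b ^ n) (1^ n) (^-mono n (<⇒≤ 0<1) 1≤b)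

  ^≤1 : ∀ {a} n → 0ℚ ≤ a → a ≤ 1ℚ → a ^ n ≤ 1ℚ
  ^≤1 {a} n 0≤a a≤1 = subst (a ^ n ≤_) (1^ n) (^-mono n 0≤a a≤1)

  ^-monoʳ : ∀ {b m n} → 1ℚ ≤ b → m ℕ.≤ n → b ^ m ≤ b ^ n
  ^-monoʳ {b} {n = n} 1≤b ℕ.z≤n = 1≤^ n 1≤b
  ^-monoʳ {b} 1≤b (ℕ.s≤s m≤n) =
    *-monoˡ-≤-nonNeg b {{nonNegative (≤-trans (<⇒≤ 0<1) 1≤b)}} (^-monoʳ 1≤b m≤n)

  *-open : ∀ {a b c} → 0ℚ ≤ b → a * b < c → ∃[ a′ ] (a < a′ × a′ * b < c)
  *-open {a} {b} {c} 0≤b ab<c with <-cmp 0ℚ b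
  ... | tri> _ _ b<0  = contradiction 0≤b (<⇒≱ b<0)
  ... | tri≈ _ refl _ = a + 1ℚ , p<p+1 a ,
        subst (_< c) (trans (*-zeroʳ a) (sym (*-zeroʳ (a + 1ℚ)))) ab<c
  ... | tri< 0<b _ _ =
        let (m , ab<m , m<c) = <-dense ab<c
            eq = trans (*-assoc m (1/ b) b) (trans (cong (m *_) (*-inverseˡ b)) (*-identityʳ m))
        in m * 1/ b ,
           *-cancelʳ-<-nonNeg b (subst (a * b <_) (sym eq) ab<m) ,
           subst (_< c) (sym eq) m<c
    where instance _ = >-nonZero 0<b
                   _ = nonNegative 0≤b

  ^-open : ∀ {q c} n → 0ℚ ≤ q → q ^ n < c → ∃[ q′ ] (q < q′ × q′ ^ n < c)
  ^-open {q} zero    0≤q 1<c = q + 1ℚ , p<p+1 q , 1<c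
  ^-open {q} {c} (suc n) 0≤q h =
    let (d , qⁿ<d , dq<c) = *-open {q ^ n} {q} 0≤q (subst (_< c) (*-comm q (q ^ n)) h)
        (q₁ , q<q₁ , q₁ⁿ<d) = ^-open n 0≤q qⁿ<d
        0≤d = ≤-trans (0≤^ n 0≤q) (<⇒≤ qⁿ<d)
        (q₂ , q<q₂ , q₂d<c) = *-open {q} {d} 0≤d (subst (_< c) (*-comm d q) dq<c)
        q<m = ⊓-glb-< q<q₁ q<q₂
        0≤m = ≤-trans 0≤q (<⇒≤ q<m)
    in q₁ ⊓ q₂ , q<m ,
       ≤-<-trans (*-mono-≤⁺ 0≤m 0≤d (p⊓q≤q q₁ q₂)
                   (≤-trans (^-mono n 0≤m (p⊓q≤p q₁ q₂)) (<⇒≤ q₁ⁿ<d)))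
                 q₂d<c
    where
    ⊓-glb-< : ∀ {x y z} → x < y → x < z → x < y ⊓ z
    ⊓-glb-< {x} {y} {z} x<y x<z with ⊓-sel y z
    ... | inj₁ e = subst (x <_) (sym e) x<y
    ... | inj₂ e = subst (x <_) (sym e) x<z

  p-q+q : ∀ p q → (p + - q) + q ≡ p
  p-q+q p q = trans (+-assoc p (- q) q)
                    (trans (cong (λ s → p + s) (+-inverseˡ q)) (+-identityʳ p))

open CutLemmas

fromℚ : ℚ → ℝ
fromℚ p = record
  { below     = _< p
  ; inhabited = p + - 1ℚ , p-1<p p
  ; bounded   = p , <-irrefl refl
  ; down      = <-trans
  ; open-up   = λ q<p → let (r , q<r , r<p) = <-dense q<p in r , q<r , r<p
  }

fromℚ⁺ : (p : ℚ) → .{{Positive p}} → ℝ⁺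
fromℚ⁺ p = record { real = fromℚ p ; pos = positive⁻¹ p }

fromℕ : ℕ → ℝ
fromℕ n = fromℚ (+ n / 1)

infixl 6 _+ʳ_
_+ʳ_ : ℝ → ℝ → ℝ
x +ʳ y = record
  { below     = λ q → ∃[ r ] ∃[ s ] (below x r × below y s × q ≡ r + s)
  ; inhabited = let (r , r∈) = inhabited x ; (s , s∈) = inhabited y
                in r + s , r , s , r∈ , s∈ , refl
  ; bounded   = let (u , u∉) = bounded x ; (v , v∉) = bounded y
                in u + v , λ (r , s , r∈ , s∈ , eq) →
                     <-irrefl (sym eq) (+-mono-< (below⇒< x u∉ r∈) (below⇒< y v∉ s∈))
  ; down      = λ { {p} p<q (r , s , r∈ , s∈ , refl) →
                    p + - s , s ,
                    down x (subst (p + - s <_) (r+s-s r s) (+-monoˡ-< (- s) p<q)) r∈ ,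
                    s∈ , sym (p-q+q p s) }
  ; open-up   = λ { (r , s , r∈ , s∈ , refl) →
                    let (r′ , r<r′ , r′∈) = open-up x r∈
                    in r′ + s , +-monoˡ-< s r<r′ , r′ , s , r′∈ , s∈ , refl }
  }
  where
  r+s-s : ∀ r s → (r + s) + - s ≡ r
  r+s-s r s = trans (+-assoc r s (- s))
                    (trans (cong (λ p → r + p) (+-inverseʳ s)) (+-identityʳ r))

infixl 7 _*⁺_
_*⁺_ : ℝ⁺ → ℝ⁺ → ℝ⁺
x *⁺ y = record { real = prod ; pos = 0∈ }
  where
  P : ℚ → Set
  P q = ∃[ r ] ∃[ s ] (0ℚ < r × below (real x) r × 0ℚ < s × below (real y) s × q ≤ r * s)

  0∈ : P 0ℚ
  0∈ = let (r , 0<r , r∈) = open-up (real x) (pos x)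
           (s , 0<s , s∈) = open-up (real y) (pos y)
       in r , s , 0<r , r∈ , 0<s , s∈ , <⇒≤ (0<* 0<r 0<s)

  prod : ℝ
  prod = record
    { below     = P
    ; inhabited = 0ℚ , 0∈
    ; bounded   = let (u , u∉) = bounded (real x) ; (v , v∉) = bounded (real y)
                  in u * v , λ (r , s , 0<r , r∈ , 0<s , s∈ , uv≤rs) →
                       let s<v = below⇒< (real y) v∉ s∈
                       in <⇒≱ (*-mono-<-≤⁺ (<⇒≤ 0<r) (<-trans 0<s s<v)
                                 (below⇒< (real x) u∉ r∈) (<⇒≤ s<v)) uv≤rs
    ; down      = λ p<q (r , s , 0<r , r∈ , 0<s , s∈ , q≤rs) →
                    r , s , 0<r , r∈ , 0<s , s∈ , ≤-trans (<⇒≤ p<q) q≤rs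
    ; open-up   = λ (r , s , 0<r , r∈ , 0<s , s∈ , q≤rs) →
                    let (r′ , r<r′ , r′∈) = open-up (real x) r∈
                    in r′ * s , ≤-<-trans q≤rs (*-monoˡ-<-pos s {{positive 0<s}} r<r′) ,
                       r′ , s , <-trans 0<r r<r′ , r′∈ , 0<s , s∈ , ≤-refl
    }

------------------------------------------------------------------------
-- Real powers of a rational base b > 1

record Base : Set where
  field
    value : ℚ
    1<    : 1ℚ < value

  instance
    value-nonZero : NonZero value
    value-nonZero = >-nonZero (<-trans 0<1 1<)

open Base using (value)

infixr 8 _^ℤ_
_^ℤ_ : Base → ℤ → ℚ
b ^ℤ (+ n)    = value b ^ n
b ^ℤ -[1+ n ] = (1/ value b) ^ suc n
  where open Base b using (value-nonZero)

-- BelowPower b t q is "q < bᵗ" for t = m / n rational, bᵗ being the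
-- positive n-th root of bᵐ.  The first disjunct is needed for q < 0, where
-- qⁿ may be large.

BelowPower : Base → ℚ → ℚ → Set
BelowPower b t q = q ≤ 0ℚ ⊎ q ^ (↧ₙ t) < b ^ℤ (↥ t)

module PowerLemmas (b : Base) where
  open Base b using (value-nonZero) renaming (1< to 1<b)

  0<b : 0ℚ < value b
  0<b = <-trans 0<1 1<b

  0<1/b : 0ℚ < 1/ value b
  0<1/b = positive⁻¹ _ {{1/pos⇒pos (value b) {{positive 0<b}}}}

  1/b≤1 : 1/ value b ≤ 1ℚ
  1/b≤1 = subst₂ _≤_ (*-identityˡ _) (*-inverseʳ (value b))
            (*-monoʳ-≤-nonNeg (1/ value b) {{nonNegative (<⇒≤ 0<1/b)}} (<⇒≤ 1<b))

  0<^ℤ : ∀ m → 0ℚ < b ^ℤ m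
  0<^ℤ (+ n)    = 0<^ n 0<b
  0<^ℤ -[1+ n ] = 0<^ (suc n) 0<1/b

  ^ℤ≤^ : ∀ m k → m ℤ.≤ + k → b ^ℤ m ≤ value b ^ k
  ^ℤ≤^ (+ n)    k (ℤ.+≤+ n≤k) = ^-monoʳ (<⇒≤ 1<b) n≤k
  ^ℤ≤^ -[1+ n ] k _ =
    ≤-trans (^≤1 (suc n) (<⇒≤ 0<1/b) 1/b≤1) (1≤^ k (<⇒≤ 1<b))

  power-down : ∀ t {p q} → p < q → BelowPower b t q → BelowPower b t p
  power-down t p<q (inj₁ q≤0) = inj₁ (≤-trans (<⇒≤ p<q) q≤0)
  power-down t {p} p<q (inj₂ h) with p ≤? 0ℚ
  ... | yes p≤0 = inj₁ p≤0
  ... | no  p≰0 = inj₂ (≤-<-trans (^-mono (↧ₙ t) (<⇒≤ (≰⇒> p≰0)) (<⇒≤ p<q)) h)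

  power-open : ∀ t {p} → BelowPower b t p → ∃[ q ] (p < q × BelowPower b t q)
  power-open t {p} h with p ≤? 0ℚ
  power-open t h | yes p≤0 =
    let (q , 0<q , qⁿ<) = ^-open {0ℚ} (↧ₙ t) ≤-refl
                            (subst (_< b ^ℤ (↥ t)) (sym (*-zeroˡ (0ℚ ^ ℚ.denominator-1 t))) (0<^ℤ (↥ t)))
    in q , ≤-<-trans p≤0 0<q , inj₂ qⁿ<
  power-open t (inj₁ p≤0) | no p≰0 = contradiction p≤0 p≰0
  power-open t (inj₂ h)   | no p≰0 =
    let (q , p<q , qⁿ<) = ^-open (↧ₙ t) (<⇒≤ (≰⇒> p≰0)) h
    in q , p<q , inj₂ qⁿ<

  power-bounded : ∀ {t u} → t < u → ¬ BelowPower b t (value b ^ ℤ.∣ ↥ u ∣)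
  power-bounded {u = u} _ (inj₁ h) = <⇒≱ (0<^ ℤ.∣ ↥ u ∣ 0<b) h
  power-bounded {t} {u} (*<* t<u) (inj₂ h) =
    <⇒≱ (subst (_< b ^ℤ (↥ t)) (^-assocʳ (value b) M (↧ₙ t)) h)
        (^ℤ≤^ (↥ t) (M ℕ.* ↧ₙ t) (m≤ (↥ t) t<u))
    where
    M = ℤ.∣ ↥ u ∣

    i≤∣i∣ : ∀ i → i ℤ.≤ + ℤ.∣ i ∣
    i≤∣i∣ (+ n)    = ℤₚ.≤-refl
    i≤∣i∣ -[1+ n ] = ℤ.-≤+

    m≤ : ∀ i → i ℤ.* ↧ u ℤ.< ↥ u ℤ.* ↧ t → i ℤ.≤ + (M ℕ.* ↧ₙ t)
    m≤ -[1+ _ ] _ = ℤ.-≤+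
    m≤ (+ j) j<   = begin
      + j                 ≤⟨ ℤ.+≤+ (ℕₚ.m≤m*n j (↧ₙ u)) ⟩
      + (j ℕ.* ↧ₙ u)      ≡⟨ ℤₚ.pos-* j (↧ₙ u) ⟩
      + j ℤ.* ↧ u         <⟨ j< ⟩
      ↥ u ℤ.* ↧ t         ≤⟨ ℤₚ.*-monoʳ-≤-nonNeg (↧ t) (i≤∣i∣ (↥ u)) ⟩
      + M ℤ.* ↧ t         ≡⟨ ℤₚ.pos-* M (↧ₙ t) ⟨
      + (M ℕ.* ↧ₙ t)      ∎
      where open ℤₚ.≤-Reasoning

-- bˣ = sup { bᵗ : t rational, t < x }

infixr 8 _^ʳ_
_^ʳ_ : Base → ℝ → ℝ⁺
b ^ʳ x = record
  { real = record
    { below     = λ q → ∃[ t ] (below x t × BelowPower b t q)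
    ; inhabited = 0ℚ , 0∈
    ; bounded   = let (u , u∉) = bounded x
                  in value b ^ ℤ.∣ ↥ u ∣ ,
                     λ (t , t∈ , h) → power-bounded (below⇒< x u∉ t∈) h
    ; down      = λ p<q (t , t∈ , h) → t , t∈ , power-down t p<q h
    ; open-up   = λ (t , t∈ , h) →
                    let (q , p<q , h′) = power-open t h in q , p<q , t , t∈ , h′
    }
  ; pos  = 0∈
  }
  where
  open PowerLemmas b

  0∈ : ∃[ t ] (below x t × BelowPower b t 0ℚ)
  0∈ = let (t , t∈) = inhabited x in t , t∈ , inj₁ ≤-refl

------------------------------------------------------------------------
-- Adapted up-arrow notation

tower : (x : ℝ⁺) (y : Base) (z : ℝ) (n : ℕ) → .{{ℕ.NonZero n}} → ℝ⁺
tower x y z (suc zero)    = x *⁺ y ^ʳ z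
tower x y z (suc (suc m)) = x *⁺ y ^ʳ real (tower x y z (suc m))

-- upArrow k x y n z is k(xy↑↑n)ᶻ.

upArrow : (k x : ℝ⁺) (y : Base) (n : ℕ) → .{{ℕ.NonZero n}} → ℝ → ℝ⁺
upArrow k x y n z = k *⁺ tower x y z n

base3 : Base
base3 = record { value = + 3 / 1 ; 1< = *<* (ℤ.+<+ (ℕ.s≤s (ℕ.s≤s ℕ.z≤n))) }

{-# OPTIONS --safe #-}

-- The least number whose squared base-3 digits sum to at least 4k + 1 is the
-- numeral 1 2 … 2 with k twos, i.e. 2 · 3ᵏ − 1, with sum exactly 4k + 1.  As
-- H₃ sends every number of height η + 1 to one of height η, γ₃(η) = 4k + 1
-- implies γ₃(η + 1) = 2 · 3ᵏ − 1, which is 4k′ + 1 for k′ = (3ᵏ − 1) / 2; the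
-- recursion starts at γ₃(2) = 13, k = 3.  On the real side, E = k + ½ gives
-- 3^(−½) · ½ · 3^E = 3ᵏ / 2 = k′ + ½, so the tower runs through the same
-- sequence of k, starting at 7/2 = 3 + ½.

module Submission where

open import Defs

module HappyNumbers where
  open import Data.Digit using (Expansion; fromDigits; toDigits)
  open import Data.Empty using (⊥-elim)
  open import Data.Fin.Base using (Fin; zero; suc; toℕ; fromℕ<)
  open import Data.Fin.Properties using (all?; toℕ-fromℕ<; toℕ<n)
  open import Data.List.Base using ([]; _∷_; map)
  open import Data.Nat.Base using (ℕ; zero; suc; _+_; _*_; _^_; _≤_; _<_; z≤n; s≤s)
  open import Data.Nat.DivMod using (_/_; _%_; _mod_; [m+kn]%n≡m%n; m<n⇒m%n≡m)
  open import Data.Nat.ListAction using (sum)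
  open import Data.Nat.Properties
  open import Data.Nat.Tactic.RingSolver using (solve-∀)
  open import Data.Product.Base using (_×_; _,_; proj₁; proj₂)
  open import Data.Sum.Base using (_⊎_; inj₁; inj₂)
  open import Relation.Binary.PropositionalEquality
  open import Relation.Nullary using (contradiction)
  open import Relation.Nullary.Decidable using (_×-dec_; _⊎-dec_; ¬?; toWitness)

  -- Sums of squared base-3 digits.

  squareSum : Expansion 3 → ℕ
  squareSum ds = sum (map (λ d → toℕ d ^ 2) ds)

  suc-last-digit : ∀ d v → suc (d + v * 3) ≡ suc d + 3 * v
  suc-last-digit = solve-∀

  2*3^suc : ∀ k → 2 * 3 ^ suc k ≡ 3 * (2 * 3 ^ k)
  2*3^suc k = lemma (3 ^ k)
    where
    lemma : ∀ x → 2 * (3 * x) ≡ 3 * (2 * x)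
    lemma = solve-∀

  3+3* : ∀ v → 3 + 3 * v ≡ 3 * suc v
  3+3* = solve-∀

  -- The remainder `suc d` is 1 or 2, so the left side lies strictly between 3v and 3(v + 1).
  suc-d+3v≢3M : ∀ d v M → suc d < 3 → suc d + 3 * v ≢ 3 * M
  suc-d+3v≢3M d v M d<2 eq with ≤-<-connex M v
  ... | inj₁ M≤v = <-irrefl (sym eq) (s≤s (≤-trans (*-monoʳ-≤ 3 M≤v) (m≤n+m (3 * v) d)))
  ... | inj₂ v<M = <-irrefl eq (<-≤-trans (+-monoˡ-< (3 * v) d<2)
                     (≤-trans (≤-reflexive (3+3* v)) (*-monoʳ-≤ 3 v<M)))

  squareSum-zero : ∀ ds → fromDigits ds ≡ 0 → squareSum ds ≡ 0
  squareSum-zero []          _  = refl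
  squareSum-zero (zero ∷ ds) eq = squareSum-zero ds (m*n≡0⇒m≡0 (fromDigits ds) 3 eq)

  fromDigits-% : ∀ (d : Fin 3) v → (toℕ d + v * 3) % 3 ≡ toℕ d
  fromDigits-% d v = trans ([m+kn]%n≡m%n (toℕ d) v 3) (m<n⇒m%n≡m (toℕ<n d))

  -- Expansions of one number differ only by zeros at the most significant end, and these add
  -- nothing. Hence `H₃` may be read off any expansion, not just the one from `toDigits`.
  squareSum-unique : ∀ ds es → fromDigits ds ≡ fromDigits es → squareSum ds ≡ squareSum es
  squareSum-unique []       es       eq = sym (squareSum-zero es (sym eq))
  squareSum-unique (d ∷ ds) []       eq = squareSum-zero (d ∷ ds) eq
  squareSum-unique (d ∷ ds) (e ∷ es) eq = cong₂ (λ a b → a ^ 2 + b) d≡e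
    (squareSum-unique ds es (*-cancelʳ-≡ (fromDigits ds) (fromDigits es) 3
      (+-cancelˡ-≡ (toℕ d) _ _ (trans eq (cong (_+ fromDigits es * 3) (sym d≡e))))))
    where
    d≡e : toℕ d ≡ toℕ e
    d≡e = trans (sym (fromDigits-% d (fromDigits ds)))
                (trans (cong (_% 3) eq) (fromDigits-% e (fromDigits es)))

  1≢2*3^k : ∀ k → 1 ≢ 2 * 3 ^ k
  1≢2*3^k k eq = contradiction (m*n≡1⇒m≡1 2 (3 ^ k) (sym eq)) λ ()

  -- For k > 0 the number is 2 modulo 3, so its last digit is 2; removing that digit takes 4 off the
  -- sum and lowers k by one. At k = 0 the number is 1.
  squareSum-extremal : ∀ k ds → suc (fromDigits ds) ≡ 2 * 3 ^ k → squareSum ds ≡ suc (4 * k)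
  squareSum-extremal k [] eq = contradiction eq (1≢2*3^k k)
  squareSum-extremal zero (zero ∷ ds) eq with fromDigits ds
  ... | zero  = contradiction eq λ ()
  ... | suc _ = contradiction eq λ ()
  squareSum-extremal zero (suc zero ∷ ds) eq =
    cong suc (squareSum-zero ds (m*n≡0⇒m≡0 (fromDigits ds) 3 (suc-injective (suc-injective eq))))
  squareSum-extremal (suc k) (d ∷ ds) eq
    with d | trans (sym (suc-last-digit (toℕ d) (fromDigits ds))) (trans eq (2*3^suc k))
  ... | zero         | eq′ = ⊥-elim (suc-d+3v≢3M 0 (fromDigits ds) (2 * 3 ^ k) (s≤s (s≤s z≤n)) eq′)
  ... | suc zero     | eq′ = ⊥-elim (suc-d+3v≢3M 1 (fromDigits ds) (2 * 3 ^ k) (s≤s (s≤s (s≤s z≤n))) eq′)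
  ... | suc (suc zero) | eq′ = trans
    (cong (4 +_) (squareSum-extremal k ds
      (*-cancelˡ-≡ _ _ 3 (trans (sym (3+3* (fromDigits ds))) eq′))))
    (lemma k)
    where
    lemma : ∀ k → 4 + suc (4 * k) ≡ suc (4 * suc k)
    lemma = solve-∀

  -- Induction on k by the last digit: a 2 contributes exactly the 4 that one step of k allows, and
  -- a smaller digit leaves slack.
  squareSum-≤ : ∀ k ds → suc (fromDigits ds) < 2 * 3 ^ k → squareSum ds ≤ 4 * k
  -- A digit 0 or 1 only gives v + 1 ≤ 2 · 3ᵏ for the rest v, so the rest may be the extremal number
  -- with sum 4k + 1. Even then the total is at most 4k + 2.
  low-digit : ∀ k ds d → d ^ 2 ≤ 1 → suc d + 3 * fromDigits ds < 3 * (2 * 3 ^ k) →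
              d ^ 2 + squareSum ds ≤ 4 * suc k

  squareSum-≤ k [] _ = z≤n
  squareSum-≤ zero ds@(_ ∷ _) (s≤s (s≤s v≤0)) = ≤-reflexive (squareSum-zero ds (n≤0⇒n≡0 v≤0))
  squareSum-≤ (suc k) (d ∷ ds) lt
    with d | subst₂ _<_ (suc-last-digit (toℕ d) (fromDigits ds)) (2*3^suc k) lt
  ... | suc (suc zero) | lt′ = ≤-trans
    (+-monoʳ-≤ 4 (squareSum-≤ k ds
      (*-cancelˡ-< 3 (suc (fromDigits ds)) (2 * 3 ^ k)
        (subst (_< 3 * (2 * 3 ^ k)) (3+3* (fromDigits ds)) lt′))))
    (≤-reflexive (sym (*-suc 4 k)))
  ... | zero     | lt′ = low-digit k ds 0 z≤n lt′
  ... | suc zero | lt′ = low-digit k ds 1 (s≤s z≤n) lt′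

  low-digit k ds d d²≤1 lt = begin
    d ^ 2 + squareSum ds  ≤⟨ +-mono-≤ d²≤1 tail-≤ ⟩
    2 + 4 * k             ≤⟨ m≤n+m (2 + 4 * k) 2 ⟩
    4 + 4 * k             ≡⟨ *-suc 4 k ⟨
    4 * suc k             ∎
    where
    open ≤-Reasoning

    tail-≤ : squareSum ds ≤ suc (4 * k)
    tail-≤ with m≤n⇒m<n∨m≡n (*-cancelˡ-< 3 (fromDigits ds) (2 * 3 ^ k)
                               (≤-<-trans (m≤n+m _ (suc d)) lt))
    ... | inj₁ v+1<M = m≤n⇒m≤1+n (squareSum-≤ k ds v+1<M)
    ... | inj₂ v+1≡M = ≤-reflexive (squareSum-extremal k ds v+1≡M)

  H₃-fromDigits : ∀ ds x → fromDigits ds ≡ x → H₃ x ≡ squareSum ds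
  H₃-fromDigits ds x eq =
    squareSum-unique (proj₁ (toDigits 3 x)) ds (trans (proj₂ (toDigits 3 x)) (sym eq))

  H₃-one : H₃ 1 ≡ 1
  H₃-one = H₃-fromDigits (suc zero ∷ []) 1 refl

  H₃-extremal : ∀ k x → suc x ≡ 2 * 3 ^ k → H₃ x ≡ suc (4 * k)
  H₃-extremal k x eq = squareSum-extremal k ds (trans (cong suc ds≡x) eq)
    where
    ds   = proj₁ (toDigits 3 x)
    ds≡x = proj₂ (toDigits 3 x)

  H₃-≤ : ∀ k x → suc x < 2 * 3 ^ k → H₃ x ≤ 4 * k
  H₃-≤ k x lt = squareSum-≤ k ds (subst (λ v → suc v < 2 * 3 ^ k) (sym ds≡x) lt)
    where
    ds   = proj₁ (toDigits 3 x)
    ds≡x = proj₂ (toDigits 3 x)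

  -- Iterates of `H₃` and heights.

  -- `H₃^` adds applications on the outside, while height arguments remove the innermost one.
  H₃^-suc : ∀ n x → H₃^ (suc n) x ≡ H₃^ n (H₃ x)
  H₃^-suc zero    x = refl
  H₃^-suc (suc n) x = cong H₃ (H₃^-suc n x)

  H₃^-zero : ∀ n → H₃^ n 0 ≡ 0
  H₃^-zero zero    = refl
  H₃^-zero (suc n) = cong H₃ (H₃^-zero n)

  -- 0 is a fixed point of `H₃` and never reaches 1, so having a height forces positivity.
  height⇒happy : ∀ n x → IsHeight x n → Happy x
  height⇒happy n zero    (eq , _) = contradiction (trans (sym (H₃^-zero n)) eq) λ ()
  height⇒happy n (suc _) (eq , _) = s≤s z≤n , n , eq

  height-H₃ : ∀ n x → IsHeight x (suc n) → IsHeight (H₃ x) n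
  height-H₃ n x (eq , least) =
    trans (sym (H₃^-suc n x)) eq ,
    λ α eq′ → ≤-pred (least (suc α) (trans (H₃^-suc α x) eq′))

  -- The case x = 1 must be excluded: 1 is a fixed point, so it has height 0 and so does its image.
  height-H₃⁻¹ : ∀ n x → x ≢ 1 → IsHeight (H₃ x) n → IsHeight x (suc n)
  height-H₃⁻¹ n x x≢1 (eq , least) = trans (H₃^-suc n x) eq , least′
    where
    least′ : ∀ α → H₃^ α x ≡ 1 → suc n ≤ α
    least′ zero    eq′ = contradiction eq′ x≢1
    least′ (suc α) eq′ = s≤s (least α (trans (sym (H₃^-suc α x)) eq′))

  -- The recursion for γ₃.

  -- The base-3 numeral 1 ... 1 with k ones, that is (3ᵏ - 1) / 2.
  repunit : ℕ → ℕ
  repunit zero    = 0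
  repunit (suc k) = suc (3 * repunit k)

  3^≡1+2*repunit : ∀ k → 3 ^ k ≡ suc (2 * repunit k)
  3^≡1+2*repunit zero    = refl
  3^≡1+2*repunit (suc k) = trans (cong (3 *_) (3^≡1+2*repunit k)) (lemma (repunit k))
    where
    lemma : ∀ r → 3 * suc (2 * r) ≡ suc (2 * suc (3 * r))
    lemma = solve-∀

  γ₃-step : ∀ n k → Isγ₃ (suc n) (suc (4 * k)) → Isγ₃ (suc (suc n)) (suc (4 * repunit k))
  γ₃-step n k ((_ , height) , least) = (height⇒happy (suc (suc n)) x height-x , height-x) , least-x
    where
    x = suc (4 * repunit k)

    suc-x : suc x ≡ 2 * 3 ^ k
    suc-x = trans (lemma (repunit k)) (cong (2 *_) (sym (3^≡1+2*repunit k)))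
      where
      lemma : ∀ r → suc (suc (4 * r)) ≡ 2 * suc (2 * r)
      lemma = solve-∀

    height-H₃x : IsHeight (H₃ x) (suc n)
    height-H₃x = subst (λ y → IsHeight y (suc n)) (sym (H₃-extremal k x suc-x)) height

    -- Otherwise `H₃ x` would be 1, of height 0 rather than `suc n`.
    x≢1 : x ≢ 1
    x≢1 x≡1 = contradiction (proj₂ height-H₃x 0 (trans (cong H₃ x≡1) H₃-one)) λ ()

    height-x : IsHeight x (suc (suc n))
    height-x = height-H₃⁻¹ (suc n) x x≢1 height-H₃x

    least-x : ∀ y → Happy y × IsHeight y (suc (suc n)) → x ≤ y
    least-x y (_ , height-y) with ≤-<-connex x y
    ... | inj₁ x≤y = x≤y
    -- Here `H₃ y` is at most 4k, yet it has height `suc n`, whose least representative is 4k + 1.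
    ... | inj₂ y<x = contradiction (H₃-≤ k y (subst (suc y <_) suc-x (s≤s y<x)))
                       (<⇒≱ (least (H₃ y) (height⇒happy (suc n) (H₃ y) h , h)))
      where h = height-H₃ (suc n) y height-y

  -- Height 2 by a finite check.

  -- Evaluating H₃ itself would evaluate the well-foundedness proofs inside
  -- toDigits, so small cases are computed from explicit digits instead.
  threeDigits : ℕ → Expansion 3
  threeDigits y = (y mod 3) ∷ (y / 3 mod 3) ∷ (y / 9 mod 3) ∷ []

  H₃-small : ∀ y → y < 27 → H₃ y ≡ squareSum (threeDigits y)
  H₃-small y y<27 = H₃-fromDigits (threeDigits y) y
    (subst (λ y → fromDigits (threeDigits y) ≡ y) (toℕ-fromℕ< y<27) (small (fromℕ< y<27)))
    where
    small : (i : Fin 27) → fromDigits (threeDigits (toℕ i)) ≡ toℕ i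
    small = toWitness {a? = all? λ i → fromDigits (threeDigits (toℕ i)) ≟ toℕ i} _

  -- The recursion cannot start at height 1, since γ₃(1) = 3 is not of the form 4k + 1. The orbit
  -- here is 13, 3, 1.
  γ₃-two : Isγ₃ 2 13
  γ₃-two = (height⇒happy 2 13 height , height) , least
    where
    H₃-13 : H₃ 13 ≡ 3
    H₃-13 = H₃-small 13 (toWitness {a? = 13 <? 27} _)

    H₃-3 : H₃ 3 ≡ 1
    H₃-3 = H₃-small 3 (toWitness {a? = 3 <? 27} _)

    height : IsHeight 13 2
    height = height-H₃⁻¹ 1 13 (λ ()) (subst (λ y → IsHeight y 1) (sym H₃-13)
      (height-H₃⁻¹ 0 3 (λ ()) (H₃-3 , λ _ _ → z≤n)))

    -- Each y < 13 has height 0, or reaches 1 after one step, or is not at 1 after two. The bound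
    -- `z < 27` allows `H₃-small` to evaluate the second step.
    small : (i : Fin 13) → let z = squareSum (threeDigits (toℕ i)) in
            z < 27 × (toℕ i ≡ 1 ⊎ z ≡ 1 ⊎ squareSum (threeDigits z) ≢ 1)
    small = toWitness {a? = all? λ i → let z = squareSum (threeDigits (toℕ i)) in
      (z <? 27) ×-dec ((toℕ i ≟ 1) ⊎-dec (z ≟ 1) ⊎-dec ¬? (squareSum (threeDigits z) ≟ 1))} _

    least : ∀ y → Happy y × IsHeight y 2 → 13 ≤ y
    least y (_ , eq , least-α) with ≤-<-connex 13 y
    ... | inj₁ 13≤y = 13≤y
    ... | inj₂ y<13 with subst (λ y → let z = squareSum (threeDigits y) in
                                  z < 27 × (y ≡ 1 ⊎ z ≡ 1 ⊎ squareSum (threeDigits z) ≢ 1))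
                           (toℕ-fromℕ< y<13) (small (fromℕ< y<13))
                       | H₃-small y (<-≤-trans y<13 (toWitness {a? = 13 ≤? 27} _))
    ...   | z<27 , inj₁ eq₀        | H₃y≡z = contradiction (least-α 0 eq₀) λ ()
    ...   | z<27 , inj₂ (inj₁ eq₁) | H₃y≡z = contradiction (least-α 1 (trans H₃y≡z eq₁)) λ { (s≤s ()) }
    ...   | z<27 , inj₂ (inj₂ eq₂) | H₃y≡z =
      contradiction (trans (sym (trans (cong H₃ H₃y≡z) (H₃-small _ z<27))) eq) eq₂

  -- The number of digits 2 in γ₃(n + 3), and equally the k with γ₃(n + 2) = 4k + 1.
  twos : ℕ → ℕ
  twos zero    = 3
  twos (suc n) = repunit (twos n)

  γ₃-closed : ∀ n → Isγ₃ (suc (suc n)) (suc (4 * twos n))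
  γ₃-closed zero    = γ₃-two
  γ₃-closed (suc n) = γ₃-step (suc n) (twos n) (γ₃-closed n)

module RationalPowers where
  open import Algebra.Bundles using (CommutativeRing)
  open import Data.Integer.Base as ℤ using (ℤ; +_; -[1+_])
  import Data.Integer.Properties as ℤₚ
  open import Data.Nat.Base as ℕ using (ℕ; zero; suc)
  import Data.Nat.Properties as ℕₚ
  open import Data.Product.Base using (∃-syntax; _×_; _,_)
  open import Data.Rational.Base hiding (_≃_)
  open import Data.Rational.Properties
  open import Data.Rational.Solver using (module +-*-Solver)
  import Data.Rational.Unnormalised.Base as ℚᵘ
  import Data.Rational.Unnormalised.Properties as ℚᵘₚ
  open import Data.Sum.Base using (inj₁; inj₂)
  open import Function.Bundles using (mk⇔; Equivalence)
  open import Relation.Binary.PropositionalEquality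
  open import Relation.Nullary using (yes; no; contradiction)
  open import Algebra.Properties.Semiring.Exp (CommutativeRing.semiring +-*-commutativeRing) using (_^_; ^-assocʳ)
  open import Algebra.Properties.CommutativeSemiring.Exp (CommutativeRing.commutativeSemiring +-*-commutativeRing) using (^-distrib-*)
  open CutLemmas
  open ℝ
  open Base using (value)

  -- Order of rational fractions and of their powers.

  x<y⇒0<y-x : ∀ {x y} → x < y → 0ℚ < y + - x
  x<y⇒0<y-x {x} {y} x<y = subst (_< y + - x) (+-inverseʳ x) (+-monoˡ-< (- x) x<y)

  ^-mono-< : ∀ {x y} n → 0ℚ ≤ x → x < y → x ^ suc n < y ^ suc n
  ^-mono-< zero    0≤x x<y = subst₂ _<_ (sym (*-identityʳ _)) (sym (*-identityʳ _)) x<y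
  ^-mono-< {x} {y} (suc n) 0≤x x<y =
    *-mono-<-≤⁺ 0≤x (0<^ (suc n) (≤-<-trans 0≤x x<y)) x<y (<⇒≤ (^-mono-< n 0≤x x<y))

  ^-cancel-< : ∀ {x y} n → 0ℚ ≤ y → x ^ n < y ^ n → x < y
  ^-cancel-< {x} {y} n 0≤y xⁿ<yⁿ with y ≤? x
  ... | yes y≤x = contradiction (^-mono n 0≤y y≤x) (<⇒≱ xⁿ<yⁿ)
  ... | no  y≰x = ≰⇒> y≰x

  -- `i / suc n` is reduced to lowest terms, so the cross-multiplied inequality is obtained through
  -- the unnormalised fraction.
  </⇒ : ∀ {t i} n → t < i / suc n → ↥ t ℤ.* + suc n ℤ.< i ℤ.* ↧ t
  </⇒ {t@record{}} {i} n t<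
    with ℚᵘₚ.<-respʳ-≃ (toℚᵘ-fromℚᵘ (ℚᵘ.mkℚᵘ i n)) (toℚᵘ-mono-< t<)
  ... | ℚᵘ.*<* lt = lt

  /</ : ∀ {i m j n} → i ℤ.* + suc n ℤ.< j ℤ.* + suc m → i / suc m < j / suc n
  /</ {i} {m} {j} {n} lt = toℚᵘ-cancel-<
    (ℚᵘₚ.<-respʳ-≃ (ℚᵘₚ.≃-sym (toℚᵘ-fromℚᵘ (ℚᵘ.mkℚᵘ j n)))
    (ℚᵘₚ.<-respˡ-≃ (ℚᵘₚ.≃-sym (toℚᵘ-fromℚᵘ (ℚᵘ.mkℚᵘ i m))) (ℚᵘ.*<* lt)))

  ↥/-↧/ : ∀ i n → ↥ (i / suc n) ℤ.* + suc n ≡ i ℤ.* ↧ (i / suc n)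
  ↥/-↧/ i n with i / suc n | toℚᵘ-fromℚᵘ (ℚᵘ.mkℚᵘ i n)
  ... | record{} | ℚᵘ.*≡* eq = eq

  p≤∣↥p∣ : ∀ p → p ≤ + ℤ.∣ ↥ p ∣ / 1
  p≤∣↥p∣ p@(mkℚ i d _) = toℚᵘ-cancel-≤
    (ℚᵘₚ.≤-respʳ-≃ (ℚᵘₚ.≃-sym (toℚᵘ-fromℚᵘ (ℚᵘ.mkℚᵘ (+ ℤ.∣ i ∣) 0))) (ℚᵘ.*≤* (lemma i)))
    where
    lemma : ∀ i → i ℤ.* + 1 ℤ.≤ + ℤ.∣ i ∣ ℤ.* + suc d
    lemma (+ n)    = subst₂ ℤ._≤_ (ℤₚ.pos-* n 1) (ℤₚ.pos-* n (suc d))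
                       (ℤ.+≤+ (ℕₚ.*-monoʳ-≤ n (ℕ.s≤s ℕ.z≤n)))
    lemma -[1+ n ] = subst (-[1+ n ] ℤ.* + 1 ℤ.≤_) (ℤₚ.pos-* (suc n) (suc d)) ℤ.-≤+

  suc/1 : ∀ n → + suc n / 1 ≡ 1ℚ + + n / 1
  suc/1 n = toℚᵘ-injective (begin
    toℚᵘ (+ suc n / 1)               ≈⟨ toℚᵘ-fromℚᵘ (ℚᵘ.mkℚᵘ (+ suc n) 0) ⟩
    ℚᵘ.mkℚᵘ (+ suc n) 0              ≈⟨ ℚᵘ.*≡* (cong (λ z → (+ 1 ℤ.+ z) ℤ.* + 1) (sym (ℤₚ.*-identityʳ (+ n)))) ⟩
    ℚᵘ.1ℚᵘ ℚᵘ.+ ℚᵘ.mkℚᵘ (+ n) 0      ≈⟨ ℚᵘₚ.+-congʳ ℚᵘ.1ℚᵘ (ℚᵘₚ.≃-sym (toℚᵘ-fromℚᵘ (ℚᵘ.mkℚᵘ (+ n) 0))) ⟩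
    ℚᵘ.1ℚᵘ ℚᵘ.+ toℚᵘ (+ n / 1)       ≈⟨ ℚᵘₚ.≃-sym (toℚᵘ-homo-+ 1ℚ (+ n / 1)) ⟩
    toℚᵘ (1ℚ + + n / 1)              ∎)
    where open import Relation.Binary.Reasoning.Setoid ℚᵘₚ.≃-setoid

  0≤n/1 : ∀ n → 0ℚ ≤ + n / 1
  0≤n/1 n = nonNegative⁻¹ (+ n / 1) {{normalize-nonNeg n 1}}

  -- Growth of rational powers.

  bernoulli : ∀ {d} n → 0ℚ ≤ d → 1ℚ + (+ n / 1) * d ≤ (1ℚ + d) ^ n
  bernoulli {d} zero 0≤d = ≤-reflexive (trans (cong (λ x → 1ℚ + x) (*-zeroˡ d)) (+-identityʳ 1ℚ))
  bernoulli {d} (suc n) 0≤d = begin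
    1ℚ + (+ suc n / 1) * d           ≡⟨ cong (λ x → 1ℚ + x * d) (suc/1 n) ⟩
    1ℚ + (1ℚ + N) * d                ≡⟨ +-identityʳ _ ⟨
    -- The added term N d² is what makes the sum factor as (1 + d)(1 + N d).
    1ℚ + (1ℚ + N) * d + 0ℚ           ≤⟨ +-monoʳ-≤ (1ℚ + (1ℚ + N) * d) 0≤ddN ⟩
    1ℚ + (1ℚ + N) * d + d * (N * d)  ≡⟨ solve 2 (λ N d → con 1ℚ :+ (con 1ℚ :+ N) :* d :+ d :* (N :* d)
                                          := (con 1ℚ :+ d) :* (con 1ℚ :+ N :* d)) refl N d ⟩
    (1ℚ + d) * (1ℚ + N * d)          ≤⟨ *-monoˡ-≤-nonNeg (1ℚ + d) {{nonNegative 0≤1+d}} (bernoulli n 0≤d) ⟩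
    (1ℚ + d) * (1ℚ + d) ^ n          ∎
    where
    open ≤-Reasoning
    open +-*-Solver
    N = + n / 1
    0≤* : ∀ {x y} → 0ℚ ≤ x → 0ℚ ≤ y → 0ℚ ≤ x * y
    0≤* {x} {y} 0≤x 0≤y = subst (_≤ x * y) (*-zeroʳ x) (*-monoˡ-≤-nonNeg x {{nonNegative 0≤x}} 0≤y)
    0≤ddN : 0ℚ ≤ d * (N * d)
    0≤ddN = 0≤* 0≤d (0≤* (0≤n/1 n) 0≤d)
    0≤1+d : 0ℚ ≤ 1ℚ + d
    0≤1+d = +-mono-≤ (<⇒≤ 0<1) 0≤d

  -- Bernoulli's inequality with d = ρ - 1 and a natural N ≥ c / d.
  ^-unbounded : ∀ {ρ} c → 1ℚ < ρ → ∃[ N ] c < ρ ^ N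
  ^-unbounded {ρ} c 1<ρ = N , (begin-strict
    c                      ≡⟨ trans (*-assoc c (1/ d) d) (trans (cong (c *_) (*-inverseˡ d)) (*-identityʳ c)) ⟨
    c * 1/ d * d           ≤⟨ *-monoʳ-≤-nonNeg d (p≤∣↥p∣ (c * 1/ d)) ⟩
    (+ N / 1) * d          <⟨ p<p+1 _ ⟩
    (+ N / 1) * d + 1ℚ     ≡⟨ +-comm ((+ N / 1) * d) 1ℚ ⟩
    1ℚ + (+ N / 1) * d     ≤⟨ bernoulli N (<⇒≤ 0<d) ⟩
    (1ℚ + d) ^ N           ≡⟨ cong (_^ N) (trans (+-comm 1ℚ d) (p-q+q ρ 1ℚ)) ⟩
    ρ ^ N                  ∎)
    where
    open ≤-Reasoning
    d = ρ + - 1ℚ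
    0<d : 0ℚ < d
    0<d = x<y⇒0<y-x 1<ρ
    instance
      _ = >-nonZero 0<d
      _ = nonNegative (<⇒≤ 0<d)
    N = ℤ.∣ ↥ (c * 1/ d) ∣

  -- Some ρ > 1 still has ρ x < y, and its powers outgrow c. The exponent is a successor because it
  -- becomes a factor of a denominator later.
  ^-ratio-unbounded : ∀ {x y} c → 0ℚ < x → x < y → ∃[ N ] c * x ^ suc N < y ^ suc N
  ^-ratio-unbounded {x} {y} c 0<x x<y =
    let (ρ , 1<ρ , ρx<y) = *-open {1ℚ} {x} {y} (<⇒≤ 0<x) (subst (_< y) (sym (*-identityˡ x)) x<y)
        (N , c<ρᴺ)       = ^-unbounded c 1<ρ
        0<ρ              = <-trans 0<1 1<ρ
    in N , (begin-strict
      c * x ^ suc N          <⟨ *-monoˡ-<-pos (x ^ suc N) {{positive (0<^ (suc N) 0<x)}}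
                                  (<-≤-trans c<ρᴺ (^-monoʳ (<⇒≤ 1<ρ) (ℕₚ.n≤1+n N))) ⟩
      ρ ^ suc N * x ^ suc N  ≡⟨ ^-distrib-* ρ x (suc N) ⟨
      (ρ * x) ^ suc N        ≤⟨ ^-mono (suc N) (<⇒≤ (0<* 0<ρ 0<x)) (<⇒≤ ρx<y) ⟩
      y ^ suc N              ∎)
    where open ≤-Reasoning

  -- Real powers with rational exponents.

  module _ (b : Base) where
    open PowerLemmas b
    open Base b using (value-nonZero)

    ^ℤ-suc : ∀ i → b ^ℤ ℤ.suc i ≡ value b * b ^ℤ i
    ^ℤ-suc (+ n)          = refl
    ^ℤ-suc -[1+ zero ]    = sym (trans (cong (value b *_) (*-identityʳ _)) (*-inverseʳ (value b)))
    ^ℤ-suc -[1+ suc n ]   = sym (trans (sym (*-assoc (value b) (1/ value b) _))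
                              (trans (cong (_* b ^ℤ -[1+ n ]) (*-inverseʳ (value b))) (*-identityˡ _)))

    ^ℤ-≤-suc : ∀ i → b ^ℤ i ≤ b ^ℤ ℤ.suc i
    ^ℤ-≤-suc i = begin
      b ^ℤ i            ≡⟨ *-identityˡ _ ⟨
      1ℚ * b ^ℤ i       ≤⟨ *-monoʳ-≤-nonNeg (b ^ℤ i) {{nonNegative (<⇒≤ (0<^ℤ i))}} (<⇒≤ (Base.1< b)) ⟩
      value b * b ^ℤ i  ≡⟨ ^ℤ-suc i ⟨
      b ^ℤ ℤ.suc i      ∎
      where open ≤-Reasoning

    ^ℤ-≤-+ : ∀ i n → b ^ℤ i ≤ b ^ℤ (+ n ℤ.+ i)
    ^ℤ-≤-+ i zero    = ≤-reflexive (cong (b ^ℤ_) (sym (ℤₚ.+-identityˡ i)))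
    ^ℤ-≤-+ i (suc n) = ≤-trans (^ℤ-≤-+ i n) (≤-trans (^ℤ-≤-suc (+ n ℤ.+ i))
      (≤-reflexive (cong (b ^ℤ_) (sym (ℤₚ.+-assoc (+ 1) (+ n) i)))))

    ^ℤ-mono : ∀ {i j} → i ℤ.≤ j → b ^ℤ i ≤ b ^ℤ j
    ^ℤ-mono {i} {j} i≤j = subst (λ k → b ^ℤ i ≤ b ^ℤ k) eq (^ℤ-≤-+ i ℤ.∣ j ℤ.- i ∣)
      where
      eq : + ℤ.∣ j ℤ.- i ∣ ℤ.+ i ≡ j
      eq = trans (cong (ℤ._+ i) (ℤₚ.0≤i⇒+∣i∣≡i (ℤₚ.i≤j⇒0≤j-i i≤j)))
           (trans (ℤₚ.+-assoc j (ℤ.- i) i)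
           (trans (cong (λ k → j ℤ.+ k) (ℤₚ.+-inverseˡ i)) (ℤₚ.+-identityʳ j)))

    ^ℤ-^ : ∀ i n → (b ^ℤ i) ^ suc n ≡ b ^ℤ (i ℤ.* + suc n)
    ^ℤ-^ (+ m)    n = trans (^-assocʳ (value b) m (suc n)) (cong (b ^ℤ_) (ℤₚ.pos-* m (suc n)))
    ^ℤ-^ -[1+ m ] n = ^-assocʳ (1/ value b) (suc m) (suc n)

    -- The hypothesis is i/n ≤ j/m; compare (mn)-th powers.
    power-weaken : ∀ {q} i n j m → 0ℚ < q → q ^ suc n < b ^ℤ i →
                   i ℤ.* + suc m ℤ.≤ j ℤ.* + suc n → q ^ suc m < b ^ℤ j
    power-weaken {q} i n j m 0<q qⁿ<bⁱ im≤jn = ^-cancel-< (suc n) (<⇒≤ (0<^ℤ j)) (begin-strict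
      (q ^ suc m) ^ suc n     ≡⟨ ^-assocʳ q (suc m) (suc n) ⟩
      q ^ (suc m ℕ.* suc n)   ≡⟨ cong (q ^_) (ℕₚ.*-comm (suc m) (suc n)) ⟩
      q ^ (suc n ℕ.* suc m)   ≡⟨ ^-assocʳ q (suc n) (suc m) ⟨
      (q ^ suc n) ^ suc m     <⟨ ^-mono-< m (<⇒≤ (0<^ (suc n) 0<q)) qⁿ<bⁱ ⟩
      (b ^ℤ i) ^ suc m        ≡⟨ ^ℤ-^ i m ⟩
      b ^ℤ (i ℤ.* + suc m)    ≤⟨ ^ℤ-mono im≤jn ⟩
      b ^ℤ (j ℤ.* + suc n)    ≡⟨ ^ℤ-^ j n ⟨
      (b ^ℤ j) ^ suc n        ∎)
      where open ≤-Reasoning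

    -- Every exponent t that witnesses membership is below i / (n + 1), so `power-weaken` carries
    -- the bound over.
    below-^ʳ⇒ : ∀ {q} i n → 0ℚ < q → below (real (b ^ʳ fromℚ (i / suc n))) q → q ^ suc n < b ^ℤ i
    below-^ʳ⇒ i n 0<q (t , t< , inj₁ q≤0) = contradiction q≤0 (<⇒≱ 0<q)
    below-^ʳ⇒ i n 0<q (t@record{} , t< , inj₂ lt) =
      power-weaken (↥ t) (ℚ.denominator-1 t) i n 0<q lt (ℤₚ.<⇒≤ (</⇒ {t} {i} n t<))

    -- The supremum runs over t strictly below i / (n + 1), so the exponent has to be lowered. After
    -- raising both sides to a high power they differ by more than a factor b, which pays for
    -- subtracting 1 from the numerator.
    below-^ʳ⇐ : ∀ {q} i n → 0ℚ < q → q ^ suc n < b ^ℤ i → below (real (b ^ʳ fromℚ (i / suc n))) q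
    below-^ʳ⇐ {q} i n 0<q lt =
      let (N , bx<y) = ^-ratio-unbounded (value b) (0<^ (suc n) 0<q) lt
          j   = ℤ.pred (i ℤ.* + suc N)
          -- Chosen so that `suc d` is definitionally `suc n * suc N`.
          d   = N ℕ.+ n ℕ.* suc N
          t   = j / suc d
          low : q ^ suc d < b ^ℤ j
          low = *-cancelˡ-<-nonNeg (value b) {{nonNegative (<⇒≤ 0<b)}} (begin-strict
            value b * q ^ suc d            ≡⟨ cong (value b *_) (^-assocʳ q (suc n) (suc N)) ⟨
            value b * (q ^ suc n) ^ suc N  <⟨ bx<y ⟩
            (b ^ℤ i) ^ suc N               ≡⟨ ^ℤ-^ i N ⟩
            b ^ℤ (i ℤ.* + suc N)           ≡⟨ cong (b ^ℤ_) (ℤₚ.suc-pred (i ℤ.* + suc N)) ⟨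
            b ^ℤ ℤ.suc j                   ≡⟨ ^ℤ-suc j ⟩
            value b * b ^ℤ j               ∎)
          t<i/n : t < i / suc n
          t<i/n = /</ {j} {d} {i} {n} (lemma N)
      -- `t` is in lowest terms; `power-weaken`, used with equality, moves `low` to that form.
      in t , t<i/n , inj₂ (power-weaken j d (↥ t) (ℚ.denominator-1 t) 0<q low (ℤₚ.≤-reflexive (sym (↥/-↧/ j d))))
      where
      open ≤-Reasoning
      lemma : ∀ N → ℤ.pred (i ℤ.* + suc N) ℤ.* + suc n ℤ.< i ℤ.* + (suc n ℕ.* suc N)
      lemma N = subst (ℤ.pred (i ℤ.* + suc N) ℤ.* + suc n ℤ.<_)
        (trans (ℤₚ.*-assoc i (+ suc N) (+ suc n)) (cong (i ℤ.*_)
          (trans (ℤₚ.*-comm (+ suc N) (+ suc n)) (sym (ℤₚ.pos-* (suc n) (suc N))))))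
        (ℤₚ.*-monoʳ-<-pos (+ suc n) {ℤ.pred (i ℤ.* + suc N)} {i ℤ.* + suc N}
          (ℤₚ.i≤pred[j]⇒i<j {ℤ.pred (i ℤ.* + suc N)} ℤₚ.≤-refl))

  -- Approximation and arithmetic of cuts.

  inverse : ∀ {μ} → 0ℚ < μ → ∃[ κ ] (0ℚ < κ × κ * μ ≡ 1ℚ)
  inverse {μ} 0<μ = (1/ μ) {{pos⇒nonZero μ}} , positive⁻¹ _ {{1/pos⇒pos μ}} , *-inverseˡ μ {{pos⇒nonZero μ}}
    where instance _ = positive 0<μ

  -- The gap between q and w is spread over n factors κ < 1, so that up to n quantities can each be
  -- pushed strictly below their bounds. Here μ > 1 satisfies μⁿ q < w and κ = 1 / μ.
  shrink : ∀ {q w} n → 0ℚ < q → q < w →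
           ∃[ μ ] ∃[ κ ] (1ℚ < μ × 0ℚ < κ × κ * μ ≡ 1ℚ × q < κ ^ n * w)
  shrink {q} {w} n 0<q q<w =
    let (a , 1<a , aq<w) = *-open {1ℚ} {q} (<⇒≤ 0<q) (subst (_< w) (sym (*-identityˡ q)) q<w)
        (μ , 1<μ , μⁿ<a) = ^-open {1ℚ} n (<⇒≤ 0<1) (subst (_< a) (sym (1^ n)) 1<a)
        0<μ              = <-trans 0<1 1<μ
        (κ , 0<κ , κμ≡1) = inverse 0<μ
    in μ , κ , 1<μ , 0<κ , κμ≡1 , (begin-strict
      q                  ≡⟨ *-identityˡ q ⟨
      1ℚ * q             ≡⟨ cong (_* q) (1^ n) ⟨
      1ℚ ^ n * q         ≡⟨ cong (λ x → x ^ n * q) κμ≡1 ⟨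
      (κ * μ) ^ n * q    ≡⟨ cong (_* q) (^-distrib-* κ μ n) ⟩
      κ ^ n * μ ^ n * q  ≡⟨ *-assoc (κ ^ n) (μ ^ n) q ⟩
      κ ^ n * (μ ^ n * q)
        <⟨ *-monoʳ-<-pos (κ ^ n) {{positive (0<^ n 0<κ)}}
             (<-trans (*-monoˡ-<-pos q {{positive 0<q}} μⁿ<a) aq<w) ⟩
      κ ^ n * w          ∎)
    where open ≤-Reasoning

  -- The largest power of μ whose square is below c.
  sqrt-approx : ∀ {c μ} → 1ℚ < c → 1ℚ < μ → ∃[ σ ] (0ℚ < σ × σ ^ 2 < c × c ≤ (σ * μ) ^ 2)
  sqrt-approx {c} {μ} 1<c 1<μ = let (N , c<μᴺ) = ^-unbounded c 1<μ in search N (begin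
    c                ≤⟨ <⇒≤ c<μᴺ ⟩
    μ ^ N            ≡⟨ *-identityʳ (μ ^ N) ⟨
    (μ ^ N) ^ 1      ≤⟨ ^-monoʳ (1≤^ N (<⇒≤ 1<μ)) (ℕ.s≤s (ℕ.z≤n {1})) ⟩
    (μ ^ N) ^ 2      ∎)
    where
    open ≤-Reasoning

    search : ∀ N → c ≤ (μ ^ N) ^ 2 → ∃[ σ ] (0ℚ < σ × σ ^ 2 < c × c ≤ (σ * μ) ^ 2)
    -- The descent stops before exponent 0, where the square is 1 < c.
    search zero    c≤1 = contradiction c≤1 (<⇒≱ 1<c)
    search (suc N) c≤  with c ≤? (μ ^ N) ^ 2
    ... | yes c≤′ = search N c≤′
    ... | no  c≰  = μ ^ N , 0<^ N (<-trans 0<1 1<μ) , ≰⇒> c≰ ,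
                    subst (λ x → c ≤ x ^ 2) (*-comm μ (μ ^ N)) c≤

  scale-< : ∀ {a x} → 0ℚ < a → x < 1ℚ → a * x < a
  scale-< {a} {x} 0<a x<1 = subst (a * x <_) (*-identityʳ a) (*-monoʳ-<-pos a {{positive 0<a}} x<1)

  inverse<1 : ∀ {κ μ} → 0ℚ < κ → 1ℚ < μ → κ * μ ≡ 1ℚ → κ < 1ℚ
  inverse<1 {κ} {μ} 0<κ 1<μ κμ≡1 =
    subst₂ _<_ (*-identityʳ κ) κμ≡1 (*-monoʳ-<-pos κ {{positive 0<κ}} 1<μ)

  -- 0 lies in the cut of a positive real, and hence every q ≤ 0 does.
  below-positive : ∀ (x : ℝ⁺) {q} → (0ℚ < q → below (real x) q) → below (real x) q
  below-positive x {q} h with q ≤? 0ℚ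
  ... | yes q≤0 = let (r , 0<r , r∈) = open-up (real x) (ℝ⁺.pos x)
                  in down (real x) (≤-<-trans q≤0 0<r) r∈
  ... | no  q≰0 = h (≰⇒> q≰0)

  *⁺-fromℚ : ∀ p .{{_ : Positive p}} (y : ℝ⁺) {r} → real y ≃ fromℚ r →
             real (fromℚ⁺ p *⁺ y) ≃ fromℚ (p * r)
  *⁺-fromℚ p y {r} y≃r q = mk⇔ to from
    where
    0<p = positive⁻¹ p
    0<r = Equivalence.to (y≃r 0ℚ) (ℝ⁺.pos y)

    to : below (real (fromℚ⁺ p *⁺ y)) q → q < p * r
    to (a , b , 0<a , a<p , 0<b , b∈ , q≤ab) = let b<r = Equivalence.to (y≃r b) b∈ in
      ≤-<-trans q≤ab (*-mono-<-≤⁺ (<⇒≤ 0<a) 0<r a<p (<⇒≤ b<r))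

    from : q < p * r → below (real (fromℚ⁺ p *⁺ y)) q
    from q<pr = below-positive (fromℚ⁺ p *⁺ y) λ 0<q →
      -- One factor κ for each of p and r.
      let (μ , κ , 1<μ , 0<κ , κμ≡1 , q<) = shrink 2 0<q q<pr
          κ<1 = inverse<1 0<κ 1<μ κμ≡1
      in p * κ , r * κ , 0<* 0<p 0<κ , scale-< 0<p κ<1 ,
         0<* 0<r 0<κ , Equivalence.from (y≃r (r * κ)) (scale-< 0<r κ<1) ,
         ≤-trans (<⇒≤ q<) (≤-reflexive (rearrange κ p r))
      where
      open +-*-Solver
      rearrange : ∀ κ p r → κ ^ 2 * (p * r) ≡ (p * κ) * (r * κ)
      rearrange = solve 3 (λ κ p r → (κ :* (κ :* con 1ℚ)) :* (p :* r) := (p :* κ) :* (r :* κ)) refl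

  +ʳ-fromℚ : ∀ {x p} s → x ≃ fromℚ p → x +ʳ fromℚ s ≃ fromℚ (p + s)
  +ʳ-fromℚ {x} {p} s x≃p q = mk⇔ to from
    where
    to : below (x +ʳ fromℚ s) q → q < p + s
    to (a , b , a∈ , b<s , refl) = +-mono-< (Equivalence.to (x≃p a) a∈) b<s

    from : q < p + s → below (x +ʳ fromℚ s) q
    from q<p+s =
      -- Splitting q as m + (q - m) works when m < p and q - m < s.
      let (m , q-s<m , m<p) = <-dense {q + - s} {p} (subst (q + - s <_) (cancel p s) (+-monoˡ-< (- s) q<p+s))
      in m , q + - m , Equivalence.from (x≃p m) m<p ,
         subst₂ _<_ (swap q s m) (swap′ s m) (+-monoˡ-< (s + - m) q-s<m) ,
         sym (trans (+-comm m (q + - m)) (p-q+q q m))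
      where
      open +-*-Solver
      cancel : ∀ p s → p + s + - s ≡ p
      cancel = solve 2 (λ p s → p :+ s :+ :- s := p) refl
      swap : ∀ q s m → q + - s + (s + - m) ≡ q + - m
      swap = solve 3 (λ q s m → q :+ :- s :+ (s :+ :- m) := q :+ :- m) refl
      swap′ : ∀ s m → m + (s + - m) ≡ s
      swap′ = solve 2 (λ s m → m :+ (s :+ :- m) := s) refl

  /-≡ : ∀ {i j} m n → i ℤ.* + suc n ≡ j ℤ.* + suc m → i / suc m ≡ j / suc n
  /-≡ {i} {j} m n eq = fromℚᵘ-cong {ℚᵘ.mkℚᵘ i m} {ℚᵘ.mkℚᵘ j n} (ℚᵘ.*≡* eq)

  /-*-/ : ∀ i j m n → (i / suc m) * (j / suc n) ≡ (i ℤ.* j) / (suc m ℕ.* suc n)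
  /-*-/ i j m n = toℚᵘ-injective (begin
    toℚᵘ ((i / suc m) * (j / suc n))         ≈⟨ toℚᵘ-homo-* (i / suc m) (j / suc n) ⟩
    toℚᵘ (i / suc m) ℚᵘ.* toℚᵘ (j / suc n)   ≈⟨ ℚᵘₚ.*-cong (toℚᵘ-fromℚᵘ (ℚᵘ.mkℚᵘ i m)) (toℚᵘ-fromℚᵘ (ℚᵘ.mkℚᵘ j n)) ⟩
    ℚᵘ.mkℚᵘ i m ℚᵘ.* ℚᵘ.mkℚᵘ j n             ≈⟨ ℚᵘₚ.≃-sym (toℚᵘ-fromℚᵘ (ℚᵘ.mkℚᵘ i m ℚᵘ.* ℚᵘ.mkℚᵘ j n)) ⟩
    toℚᵘ ((i ℤ.* j) / (suc m ℕ.* suc n))     ∎)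
    where open import Relation.Binary.Reasoning.Setoid ℚᵘₚ.≃-setoid

  /1-^ : ∀ a k → (+ a / 1) ^ k ≡ + (a ℕ.^ k) / 1
  /1-^ a zero    = refl
  /1-^ a (suc k) = trans (cong ((+ a / 1) *_) (/1-^ a k))
    (trans (/-*-/ (+ a) (+ (a ℕ.^ k)) 0 0) (cong (_/ 1) (sym (ℤₚ.pos-* a (a ℕ.^ k)))))

  ^ʳ-mono : ∀ b x y → (∀ t → below x t → below y t) →
            ∀ {q} → below (real (b ^ʳ x)) q → below (real (b ^ʳ y)) q
  ^ʳ-mono b x y x⊆y (t , t∈ , h) = t , x⊆y t t∈ , h

  -- One storey of the tower.

  1/√3·½ : ℝ⁺
  1/√3·½ = base3 ^ʳ fromℚ (- ½) *⁺ fromℚ⁺ ½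

  -- For q > 0, q lies below 3^(k + ½) iff q² < 3 · (3ᵏ)², and below 3^(-½) iff q² < ⅓.
  tower-step : ∀ k z → z ≃ fromℚ (+ suc (2 ℕ.* k) / 2) →
               real (1/√3·½ *⁺ base3 ^ʳ z) ≃ fromℚ (+ (3 ℕ.^ k) / 2)
  tower-step k z z≃ q = mk⇔ (λ h → subst (q <_) p½≡ (to h)) (λ h → from (subst (q <_) (sym p½≡) h))
    where
    open ≤-Reasoning
    open +-*-Solver

    three ⅓ p : ℚ
    three = + 3 / 1
    ⅓ = + 1 / 3
    p = three ^ k

    three*⅓ : three * ⅓ ≡ 1ℚ
    three*⅓ = refl

    0<three : 0ℚ < three
    0<three = *<* (ℤ.+<+ (ℕ.s≤s ℕ.z≤n))

    0<⅓ : 0ℚ < ⅓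
    0<⅓ = *<* (ℤ.+<+ (ℕ.s≤s ℕ.z≤n))

    0<½ : 0ℚ < ½
    0<½ = *<* (ℤ.+<+ (ℕ.s≤s ℕ.z≤n))

    0<p : 0ℚ < p
    0<p = 0<^ k 0<three

    p½≡ : p * ½ ≡ + (3 ℕ.^ k) / 2
    p½≡ = trans (cong (_* ½) (/1-^ 3 k))
      (trans (/-*-/ (+ (3 ℕ.^ k)) (+ 1) 0 1) (cong (_/ 2) (ℤₚ.*-identityʳ (+ (3 ℕ.^ k)))))

    3^[2k+1] : three ^ suc (2 ℕ.* k) ≡ three * p ^ 2
    3^[2k+1] = cong (three *_) (trans (cong (three ^_) (ℕₚ.*-comm 2 k)) (sym (^-assocʳ three k 2)))

    to : below (real (1/√3·½ *⁺ base3 ^ʳ z)) q → q < p * ½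
    to (r , s , 0<r , (r₁ , r₂ , 0<r₁ , r₁∈ , 0<r₂ , r₂<½ , r≤r₁r₂) , 0<s , s∈ , q≤rs) =
      begin-strict
        q              ≤⟨ q≤rs ⟩
        r * s          ≤⟨ *-monoʳ-≤-nonNeg s {{nonNegative (<⇒≤ 0<s)}} r≤r₁r₂ ⟩
        r₁ * r₂ * s    ≡⟨ solve 3 (λ r₁ r₂ s → r₁ :* r₂ :* s := (r₁ :* s) :* r₂) refl r₁ r₂ s ⟩
        (r₁ * s) * r₂  <⟨ *-mono-<-≤⁺ (<⇒≤ (0<* 0<r₁ 0<s)) 0<½ r₁s<p (<⇒≤ r₂<½) ⟩
        p * ½          ∎
      where
      r₁²<⅓ : r₁ ^ 2 < ⅓
      -- -½ is read as -1 over 2, and `base3 ^ℤ -[1+ 0 ]` computes to ⅓.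
      r₁²<⅓ = below-^ʳ⇒ base3 -[1+ 0 ] 1 0<r₁ r₁∈

      s²<3p² : s ^ 2 < three * p ^ 2
      s²<3p² = subst (s ^ 2 <_) 3^[2k+1]
        (below-^ʳ⇒ base3 (+ suc (2 ℕ.* k)) 1 0<s
          (^ʳ-mono base3 z (fromℚ (+ suc (2 ℕ.* k) / 2)) (λ t → Equivalence.to (z≃ t)) s∈))

      -- Squaring removes √3: the bounds ⅓ and 3p² multiply to p².
      r₁s<p : r₁ * s < p
      r₁s<p = ^-cancel-< 2 (<⇒≤ 0<p) (begin-strict
        (r₁ * s) ^ 2         ≡⟨ ^-distrib-* r₁ s 2 ⟩
        r₁ ^ 2 * s ^ 2       <⟨ *-mono-<-≤⁺ (0≤^ 2 (<⇒≤ 0<r₁)) (0<* 0<three (0<^ 2 0<p)) r₁²<⅓ (<⇒≤ s²<3p²) ⟩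
        ⅓ * (three * p ^ 2)  ≡⟨ *-assoc ⅓ three (p ^ 2) ⟨
        ⅓ * three * p ^ 2    ≡⟨ cong (_* p ^ 2) (trans (*-comm ⅓ three) three*⅓) ⟩
        1ℚ * p ^ 2           ≡⟨ *-identityˡ (p ^ 2) ⟩
        p ^ 2                ∎)

    -- σ approximates √3 from below up to the factor μ, so σ / 3 lies below 3^(-½) and σ p below √3
    -- p. Their product σ² p / 3 is at least κ² p; the third κ keeps the factor ½ strictly below its
    -- bound, hence the exponent 3.
    from-σ : ∀ {μ κ} → 1ℚ < μ → 0ℚ < κ → κ * μ ≡ 1ℚ → q < κ ^ 3 * (p * ½) →
             ∃[ σ ] (0ℚ < σ × σ ^ 2 < three × three ≤ (σ * μ) ^ 2) →
             below (real (1/√3·½ *⁺ base3 ^ʳ z)) q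
    from-σ {μ} {κ} 1<μ 0<κ κμ≡1 q< (σ , 0<σ , σ²<3 , 3≤) =
      σ * ⅓ * (½ * κ) , σ * p , 0<* 0<r₁ 0<r₂ ,
      (σ * ⅓ , ½ * κ , 0<r₁ , r₁∈ , 0<r₂ , scale-< 0<½ (inverse<1 0<κ 1<μ κμ≡1) , ≤-refl) ,
      0<s , s∈ , bound
      where
      0<r₁ : 0ℚ < σ * ⅓
      0<r₁ = 0<* 0<σ 0<⅓

      0<r₂ : 0ℚ < ½ * κ
      0<r₂ = 0<* 0<½ 0<κ

      0<s : 0ℚ < σ * p
      0<s = 0<* 0<σ 0<p

      r₁∈ : below (real (base3 ^ʳ fromℚ (- ½))) (σ * ⅓)
      r₁∈ = below-^ʳ⇐ base3 -[1+ 0 ] 1 0<r₁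
        (subst (_< ⅓) (sym (^-distrib-* σ ⅓ 2)) (*-monoˡ-<-pos (⅓ ^ 2) σ²<3))

      s∈ : below (real (base3 ^ʳ z)) (σ * p)
      s∈ = ^ʳ-mono base3 (fromℚ (+ suc (2 ℕ.* k) / 2)) z (λ t → Equivalence.from (z≃ t))
        (below-^ʳ⇐ base3 (+ suc (2 ℕ.* k)) 1 0<s
        (subst₂ _<_ (sym (^-distrib-* σ p 2)) (sym 3^[2k+1])
          (*-monoˡ-<-pos (p ^ 2) {{positive (0<^ 2 0<p)}} σ²<3)))

      rearrange : ∀ σ μ κ p a b →
                  (σ * μ) ^ 2 * (a * (κ ^ 3 * (p * b))) ≡ (κ * μ) ^ 2 * (σ * a * (b * κ) * (σ * p))
      rearrange = solve 6 (λ σ μ κ p a b →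
        (σ :* μ) :* ((σ :* μ) :* con 1ℚ) :* (a :* (κ :* (κ :* (κ :* con 1ℚ)) :* (p :* b))) :=
        (κ :* μ) :* ((κ :* μ) :* con 1ℚ) :* (σ :* a :* (b :* κ) :* (σ :* p))) refl

      bound : q ≤ σ * ⅓ * (½ * κ) * (σ * p)
      bound = begin
        q                                ≤⟨ <⇒≤ q< ⟩
        κ ^ 3 * (p * ½)                  ≡⟨ *-identityˡ (κ ^ 3 * (p * ½)) ⟨
        1ℚ * (κ ^ 3 * (p * ½))           ≡⟨ cong (_* (κ ^ 3 * (p * ½))) three*⅓ ⟨
        three * ⅓ * (κ ^ 3 * (p * ½))    ≡⟨ *-assoc three ⅓ (κ ^ 3 * (p * ½)) ⟩
        three * w                        ≤⟨ *-monoʳ-≤-nonNeg w {{nonNegative (<⇒≤ 0<w)}} 3≤ ⟩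
        (σ * μ) ^ 2 * w                  ≡⟨ rearrange σ μ κ p ⅓ ½ ⟩
        (κ * μ) ^ 2 * v                  ≡⟨ cong (_* v) (trans (cong (_^ 2) κμ≡1) (1^ 2)) ⟩
        1ℚ * v                           ≡⟨ *-identityˡ v ⟩
        v                                ∎
        where
        w = ⅓ * (κ ^ 3 * (p * ½))
        v = σ * ⅓ * (½ * κ) * (σ * p)
        0<w : 0ℚ < w
        0<w = 0<* 0<⅓ (0<* (0<^ 3 0<κ) (0<* 0<p 0<½))

    from-κ : ∃[ μ ] ∃[ κ ] (1ℚ < μ × 0ℚ < κ × κ * μ ≡ 1ℚ × q < κ ^ 3 * (p * ½)) →
             below (real (1/√3·½ *⁺ base3 ^ʳ z)) q
    from-κ (μ , κ , 1<μ , 0<κ , κμ≡1 , q<) =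
      from-σ 1<μ 0<κ κμ≡1 q< (sqrt-approx (Base.1< base3) 1<μ)

    from : q < p * ½ → below (real (1/√3·½ *⁺ base3 ^ʳ z)) q
    from q<p½ = below-positive (1/√3·½ *⁺ base3 ^ʳ z) λ 0<q → from-κ (shrink 3 0<q q<p½)

-- Closed form of the tower.

module TowerValues where
  open import Data.Integer.Base as ℤ using (+_)
  import Data.Integer.Properties as ℤₚ
  open import Data.Nat.Base as ℕ using (ℕ; zero; suc)
  open import Data.Nat.Tactic.RingSolver using (solve-∀)
  open import Data.Rational.Base using (_/_; _+_; _*_; -_; 1ℚ)
  open import Data.Rational.Solver using (module +-*-Solver)
  open import Function.Base using (id)
  open import Function.Bundles using (mk⇔; Equivalence)
  open import Relation.Binary.PropositionalEquality
  open HappyNumbers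
  open RationalPowers

  E : ℕ → ℝ⁺
  E n = tower 1/√3·½ base3 (fromℚ (+ 7 / 2)) (suc n)

  -- `E n` is E with index n + 1. Its value 3ᵏ / 2 for k = `twos n` is rewritten as `twos (suc n)` +
  -- ½, the shape that the next application of `tower-step` requires.
  E-closed : ∀ n → real (E n) ≃ fromℚ (+ suc (2 ℕ.* twos (suc n)) / 2)
  E-closed n = subst (λ m → real (E n) ≃ fromℚ (+ m / 2)) (3^≡1+2*repunit (twos n)) (step n)
    where
    step : ∀ n → real (E n) ≃ fromℚ (+ (3 ℕ.^ twos n) / 2)
    -- 7/2 is already 3 + ½ with 3 = `twos 0`.
    step zero    = tower-step 3 (fromℚ (+ 7 / 2)) (λ q → mk⇔ id id)
    step (suc n) = tower-step (twos (suc n)) (real (E n)) (E-closed n)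

  4[h+½]-1 : ∀ h → (+ 4 / 1) * (+ suc (2 ℕ.* h) / 2) + - 1ℚ ≡ + suc (4 ℕ.* h) / 1
  4[h+½]-1 h = begin
    (+ 4 / 1) * (+ suc (2 ℕ.* h) / 2) + - 1ℚ
      ≡⟨ cong (λ x → x + - 1ℚ) (/-*-/ (+ 4) (+ suc (2 ℕ.* h)) 0 1) ⟩
    (+ 4 ℤ.* + suc (2 ℕ.* h)) / 2 + - 1ℚ
      ≡⟨ cong (λ x → x + - 1ℚ) (/-≡ {+ 4 ℤ.* + suc (2 ℕ.* h)} {+ suc (suc (4 ℕ.* h))} 1 0 cross) ⟩
    + suc (suc (4 ℕ.* h)) / 1 + - 1ℚ
      ≡⟨ cong (λ x → x + - 1ℚ) (suc/1 (suc (4 ℕ.* h))) ⟩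
    1ℚ + + suc (4 ℕ.* h) / 1 + - 1ℚ
      ≡⟨ cancel (+ suc (4 ℕ.* h) / 1) ⟩
    + suc (4 ℕ.* h) / 1
      ∎
    where
    open ≡-Reasoning

    cancel : ∀ x → 1ℚ + x + - 1ℚ ≡ x
    cancel = solve 1 (λ x → con 1ℚ :+ x :+ :- con 1ℚ := x) refl
      where open +-*-Solver

    crossℕ : ∀ h → 4 ℕ.* suc (2 ℕ.* h) ℕ.* 1 ≡ suc (suc (4 ℕ.* h)) ℕ.* 2
    crossℕ = solve-∀

    cross : + 4 ℤ.* + suc (2 ℕ.* h) ℤ.* + 1 ≡ + suc (suc (4 ℕ.* h)) ℤ.* + 2
    cross = trans (cong (ℤ._* + 1) (sym (ℤₚ.pos-* 4 (suc (2 ℕ.* h)))))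
      (trans (sym (ℤₚ.pos-* (4 ℕ.* suc (2 ℕ.* h)) 1))
      (trans (cong +_ (crossℕ h)) (ℤₚ.pos-* (suc (suc (4 ℕ.* h))) 2)))

  ≃-sym : ∀ {x y} → x ≃ y → y ≃ x
  ≃-sym x≃y q = mk⇔ (Equivalence.from (x≃y q)) (Equivalence.to (x≃y q))

  upArrow-closed : ∀ n → fromℕ (suc (4 ℕ.* twos (suc n)))
                         ≃ real (fromℚ⁺ (+ 4 / 1) *⁺ E n) +ʳ fromℚ (- 1ℚ)
  upArrow-closed n = ≃-sym
    {real (fromℚ⁺ (+ 4 / 1) *⁺ E n) +ʳ fromℚ (- 1ℚ)} {fromℕ (suc (4 ℕ.* twos (suc n)))}
    (subst (λ v → real (fromℚ⁺ (+ 4 / 1) *⁺ E n) +ʳ fromℚ (- 1ℚ) ≃ fromℚ v) (4[h+½]-1 (twos (suc n)))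
      (+ʳ-fromℚ {real (fromℚ⁺ (+ 4 / 1) *⁺ E n)} (- 1ℚ) (*⁺-fromℚ (+ 4 / 1) (E n) (E-closed n))))

-- The formula for γ₃.

open import Data.Integer.Base using (+_)
open import Data.Nat.Base using (ℕ; suc; _<_; _∸_; _*_; s≤s; z≤n; >-nonZero)
open import Data.Nat.Properties using (m<n⇒0<n∸m)
open import Data.Product.Base using (_×_; _,_; ∃-syntax)
open import Data.Rational.Base using (_/_; -_; ½; 1ℚ)
open HappyNumbers using (twos; γ₃-closed)
open TowerValues using (upArrow-closed)

theorem5p2 : (η : ℕ) (2<η : 2 < η) →
    ∃[ g ] (Isγ₃ η g ×
    fromℕ g ≃
    real (upArrow (fromℚ⁺ (+ 4 / 1)) (base3 ^ʳ fromℚ (- ½) *⁺ fromℚ⁺ ½) base3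
    (η ∸ 2) {{>-nonZero (m<n⇒0<n∸m 2<η)}} (fromℚ (+ 7 / 2)))
    +ʳ fromℚ (- 1ℚ))
theorem5p2 (suc (suc (suc n))) (s≤s (s≤s (s≤s z≤n))) =
  -- With η = n + 3 the tower has height n + 1, which is `E n`.
  suc (4 * twos (suc n)) , γ₃-closed (suc n) , upArrow-closed n
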